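{- For every field $\mathbb{F}$, all $n,d\ge1$ and every $n^d\times n^d$ matrix $M$ over $\mathbb{F}$, \[ \mathcal L_{\mathsf{nc,sm}}\big(\mathrm{ShiftedTensor}(M)\big)\ \ge\ \frac{\mathrm{PT\text{ - }rank}(M)}{n^{\,d-\log_2 d+1}}. \]
   Context: Non-commutative set-multilinear formula size of a tensor $A:[N]^k\to\mathbb{F}$: if $k=1$, $\mathcal L_{\mathsf{nc,sm}}(A)$ is $1$ if $A\ne0$ and $0$ otherwise; if $k\ge2$ it is the minimum of $\sum_i(\mathcal L_{\mathsf{nc,sm}}(B_i)+\mathcal L_{\mathsf{nc,sm}}(C_i))$ over finite families $(e_i,f_i,B_i,C_i)$ with positive integers $e_i+f_i=k$, $B_i:[N]^{e_i}\to\mathbb{F}$, $C_i:[N]^{f_i}\to\mathbb{F}$, $A=\sum_iB_i\otimes C_i$ (where $(B\otimes C)(x,y)=B(x)C(y)$, concatenating coordinates in order). Pairing $\langle i,j\rangle=(i-1)n+j$. $\mathrm{ShiftedTensor}(M):[n^2]^{d+1}\to\mathbb{F}$, $\mathrm{ShiftedTensor}(M)(\langle p,i_1\rangle,\langle j_1,i_2\rangle,\dots,\langle j_{d-1},i_d\rangle,\langle j_d,q\rangle)=\mathbb 1\{p=q=1\}M_{(i_1,\dots,i_d),(j_1,\dots,j_d)}$. Partial transposes: for $k\in[d]$, $M^{\top_k}$ swaps the $k$-th row index with the $k$-th column index; $M^{\top_\kappa}$ composes these over $k\in\kappa\subseteq[d]$. $M$ is PT-basic if $\mathrm{rank}(M^{\top_\kappa})=1$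 for some $\kappa$; $\mathrm{PT\text{ - }rank}(M)$ is the least number of PT-basic matrices summing to $M$. Logs base 2. -}

module Defs where

open import Level using (Level; _⊔_; Lift) renaming (suc to lsuc)
open import Algebra.Bundles using (CommutativeRing)
open import Data.Bool.Base using (if_then_else_; _∧_)
open import Data.Empty.Polymorphic using (⊥)
open import Data.Fin.Base using (Fin; toℕ; quotient; remainder)
open import Data.Fin.Subset using (Subset)
open import Data.List.Base as List using (allFin)
open import Data.Nat.Base
  using (ℕ; suc; _+_; _*_; _^_; _≤_; _<_; _≡ᵇ_; NonZero)
open import Data.Nat.Induction using (Acc; acc; <-wellFounded)
open import Data.Nat.Properties using (+-0-monoid; m<m+n; m<n+m)
open import Data.Product.Base using (Σ; _×_)
open import Data.Sum.Base using (_⊎_)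
open import Data.Vec.Base as Vec
  using (Vec; lookup; _[_]≔_; cast; take; drop; head; last; init; tail)
open import Data.Vec.Functional using (Vector)
open import Relation.Nullary.Negation using (¬_)
open import Relation.Binary.PropositionalEquality using (_≡_; sym; subst)

import Algebra.Definitions
import Algebra.Properties.Monoid.Sum

open Algebra.Properties.Monoid.Sum +-0-monoid using () renaming (sum to sumℕ) public

private variable
  a : Level

IsLeast : (ℕ → Set a) → ℕ → Set a
IsLeast P s = P s × (∀ t → P t → s ≤ t)

IsGreatest : (ℕ → Set a) → ℕ → Set a
IsGreatest P s = P s × (∀ t → P t → t ≤ s)

-- A non-negative real exponent x, given by its rational upper bounds:
-- x a b is read as "x ≤ a / b", for b ≥ 1.
Exponent : Set₁
Exponent = ℕ → ℕ → Set

-- The real number d − log₂ d + 1 (positive, for d ≥ 1):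
-- d − log₂ d + 1 ≤ a / b  iff  b (d + 1) ≤ a + b log₂ d.
d-log₂d+1 : ℕ → Exponent
d-log₂d+1 d a b = 2 ^ (b * (d + 1)) ≤ 2 ^ a * d ^ b

-- L ≥ r / n ^ʳ x says L ≥ r / nˣ, for n ≥ 1. As q ↦ n^q is continuous and
-- non-decreasing, r ≤ L nˣ iff r ≤ L n^(a/b) for every rational a/b ≥ x;
-- the latter is stated after raising both sides to the power b.
infix 4 _≥_/_^ʳ_
_≥_/_^ʳ_ : ℕ → ℕ → ℕ → Exponent → Set
L ≥ r / n ^ʳ x = ∀ a b → .{{NonZero b}} → x a b → r ^ b ≤ L ^ b * n ^ a

record Field c ℓ : Set (lsuc (c ⊔ ℓ)) where
  field
    commutativeRing : CommutativeRing c ℓ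
  open CommutativeRing commutativeRing public
    renaming (_+_ to _+F_; _*_ to _*F_)
  open Algebra.Definitions _≈_ public using (Invertible)
  field
    1≉0     : ¬ (1# ≈ 0#)
    inverse : ∀ x → ¬ (x ≈ 0#) → Invertible 1# _*F_ x

module _ {c ℓ : Level} (F : Field c ℓ) where

  open Field F using (Carrier; _≈_; 0#; _*F_; +-monoid)
  open Algebra.Properties.Monoid.Sum +-monoid using (sum)

  Tensor : ℕ → ℕ → Set c
  Tensor N k = Vec (Fin N) k → Carrier

  IsZero : ∀ {N k} → Tensor N k → Set ℓ
  IsZero A = ∀ x → A x ≈ 0#

  tensorProduct : ∀ {N e f} → Tensor N e → Tensor N f → Tensor N (e + f)
  tensorProduct {e = e} B C z = B (take e z) *F C (drop e z)

  record ProductTerm (N k : ℕ) : Set c where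
    field
      e f    : ℕ
      0<e    : 0 < e
      0<f    : 0 < f
      e+f≡k  : e + f ≡ k
      B      : Tensor N e
      C      : Tensor N f

    term : Tensor N k
    term x = tensorProduct B C (cast (sym e+f≡k) x)

    e<k : e < k
    e<k = subst (e <_) e+f≡k (m<m+n e 0<f)

    f<k : f < k
    f<k = subst (f <_) e+f≡k (m<n+m f 0<e)

  -- The recursion on the order k is well-founded since e, f < k. Order 0
  -- never occurs.
  IsNcSmSizeAcc : ∀ {N} k → Acc _<_ k → Tensor N k → ℕ → Set (c ⊔ ℓ)
  IsNcSmSizeAcc 0 _ A s = ⊥
  IsNcSmSizeAcc 1 _ A s = Lift c ((¬ IsZero A × s ≡ 1) ⊎ (IsZero A × s ≡ 0))
  IsNcSmSizeAcc {N} k@(suc (suc _)) (acc rec) A = IsLeast λ s →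
    Σ ℕ λ m → Σ (Vector (ProductTerm N k) m) λ P →
    Σ (Vector ℕ m) λ β → Σ (Vector ℕ m) λ γ →
      (∀ i → IsNcSmSizeAcc (e (P i)) (rec (e<k (P i))) (B (P i)) (β i))
    × (∀ i → IsNcSmSizeAcc (f (P i)) (rec (f<k (P i))) (C (P i)) (γ i))
    × (∀ x → A x ≈ sum (λ i → term (P i) x))
    × s ≡ sumℕ (λ i → β i + γ i)
    where open ProductTerm

  -- IsNcSmSize A s: the non-commutative set-multilinear formula size of A is s.
  IsNcSmSize : ∀ {N k} → Tensor N k → ℕ → Set (c ⊔ ℓ)
  IsNcSmSize {k = k} = IsNcSmSizeAcc k (<-wellFounded k)

  -- An n^d × n^d matrix, its rows and columns indexed by d-tuples over [n].
  Matrix : ℕ → ℕ → Set c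
  Matrix n d = Vec (Fin n) d → Vec (Fin n) d → Carrier

  LinearlyIndependent : ∀ {i} {I : Set i} {m} → Vector (I → Carrier) m → Set (c ⊔ ℓ ⊔ i)
  LinearlyIndependent {m = m} v =
    ∀ (α : Vector Carrier m) → (∀ i → sum (λ k → α k *F v k i) ≈ 0#) → ∀ k → α k ≈ 0#

  -- Rank as the maximal number of linearly independent columns.
  IsRank : ∀ {n d} → Matrix n d → ℕ → Set (c ⊔ ℓ)
  IsRank {n} {d} M = IsGreatest λ m →
    Σ (Vector (Vec (Fin n) d) m) λ js → LinearlyIndependent (λ k i → M i (js k))

  partialTranspose : ∀ {n d} → Fin d → Matrix n d → Matrix n d
  partialTranspose k M i j = M (i [ k ]≔ lookup j k) (j [ k ]≔ lookup i k)

  partialTransposes : ∀ {n d} → Subset d → Matrix n d → Matrix n d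
  partialTransposes {d = d} κ M =
    List.foldr (λ k M′ → if lookup κ k then partialTranspose k M′ else M′) M (allFin d)

  PTBasic : ∀ {n d} → Matrix n d → Set (c ⊔ ℓ)
  PTBasic {d = d} M = Σ (Subset d) λ κ → IsRank (partialTransposes κ M) 1

  IsPTRank : ∀ {n d} → Matrix n d → ℕ → Set (c ⊔ ℓ)
  IsPTRank {n} {d} M = IsLeast λ r →
    Σ (Vector (Matrix n d) r) λ B →
      (∀ k → PTBasic (B k)) × (∀ i j → M i j ≈ sum (λ k → B k i j))

  -- With indices counted from 0 the pairing ⟨i , j⟩ is combine i j, with inverse
  -- (quotient , remainder). On (⟨p,i₁⟩ , ⟨j₁,i₂⟩ , … , ⟨j_d,q⟩) the remainders of
  -- the first d coordinates are i₁ … i_d and the quotients of the last d are j₁ … j_d.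
  ShiftedTensor : ∀ {n d} → Matrix n d → Tensor (n * n) (suc d)
  ShiftedTensor {n} M x =
    if (toℕ p ≡ᵇ 0) ∧ (toℕ q ≡ᵇ 0)
    then M (Vec.map (remainder {n} n) (init x)) (Vec.map (quotient {n} n) (tail x))
    else 0#
    where
    p q : Fin n
    p = quotient {n} n (head x)
    q = remainder {n} n (last x)

{-# OPTIONS --safe #-}
module Submission where

-- Write A = Σ Bᵢ ⊗ Cᵢ as in an optimal formula and expand recursively only the factor of
-- larger order: a formula of size s over k ≥ 2^l coordinates becomes a sum of s products of
-- l + 1 tensors on consecutive intervals. In such a product, give the factors alternately
-- to rows and columns. A pair (i_t , j_t) cut by the product needs no more than a partial
-- transpose to be split between rows and columns, while an uncut pair is separated by
-- summing over the n values of j_t. Hence the shifted tensor of M becomes a sum of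
-- s · n^(d - l) PT-basic matrices. For 2^l ≤ d + 1 < 2^(l + 1) this is the bound.
-- Equality in F is not decidable, so discarding the zero summands takes a double negation,
-- which is removed since the claim is an inequality of natural numbers.

open import Defs
open import Algebra.Bundles using (CommutativeRing)
open import Data.Bool.Base using (Bool; true; false; not; if_then_else_; _xor_)
open import Data.Fin.Base using (Fin; zero; suc; quotient; remainder; combine)
open import Data.Fin.Properties using (remQuot-combine; combine-remQuot)
open import Data.Fin.Subset using (Subset)
open import Data.List.Base as List using ([]; _∷_)
open import Data.Nat.Base
  using (ℕ; zero; suc; pred; _+_; _*_; _^_; _≤_; _<_; z≤n; s≤s; NonZero)
open import Data.Nat.Induction using (Acc; acc; <-wellFounded)
open import Data.Nat.Properties as ℕ using
  ( [m*n]*[o*p]≡[m*o]*[n*p]; _<?_; _≤?_; ≮⇒≥; <⇒≱; <⇒≤; n≤1+n; m≤n⇒m≤1+n; m≤m+n; m≤n+m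
  ; ≤-refl; ≤-trans; ≤-total; <-≤-trans; +-mono-≤; +-monoʳ-≤; *-monoˡ-≤; *-monoʳ-≤
  ; *-cancelˡ-≤; *-cancelʳ-≤; m^n>0; m^n≢0; ^-monoˡ-≤; ^-monoʳ-≤; ^-monoʳ-<; ^-*-assoc
  ; ^-distribˡ-+-* )
open import Data.Nat.Tactic.RingSolver using (solve-∀)
open import Data.Product.Base using (Σ; ∃; _×_; _,_; proj₁; proj₂; curry)
open import Data.Sum.Base using (_⊎_; inj₁; inj₂)
open import Data.Vec.Base as Vec
  using (Vec; []; _∷_; lookup; _++_; cast; take; drop; head; last; init; tail)
open import Data.Vec.Functional using (Vector)
open import Data.Vec.Properties using (cast-is-id)
open import Function.Base using (_∘_; id)
open import Level using (Level; _⊔_; lift)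
open import Relation.Binary.PropositionalEquality as ≡
  using (_≡_; refl; cong; cong₂; subst)
open import Relation.Nullary using (¬_; yes; no; contradiction)
open import Relation.Nullary.Decidable using (decidable-stable; ¬¬-excluded-middle)

import Algebra.Properties.CommutativeSemigroup
import Algebra.Properties.Ring
import Algebra.Properties.Semiring.Sum
import Relation.Binary.Reasoning.Setoid

private variable
  c ℓ ℓ₁ ℓ₂ ℓ₃ : Level
  X Y Z : Set
  k m n d r s : ℕ

-- Arithmetic: logarithms, counting and the exponent of the bound.

^-distribʳ-* : ∀ x y b → (x * y) ^ b ≡ x ^ b * y ^ b
^-distribʳ-* x y zero = refl
^-distribʳ-* x y (suc b) rewrite ^-distribʳ-* x y b = [m*n]*[o*p]≡[m*o]*[n*p] x y (x ^ b) (y ^ b)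

∃⌊log₂⌋ : ∀ d → ∃ λ e → 2 ^ e ≤ suc d × suc d < 2 ^ suc e
∃⌊log₂⌋ zero = 0 , s≤s z≤n , s≤s (s≤s z≤n)
∃⌊log₂⌋ (suc d) with ∃⌊log₂⌋ d
... | e , lo , hi with suc (suc d) <? 2 ^ suc e
... | yes p = e , m≤n⇒m≤1+n lo , p
... | no p = suc e , ≮⇒≥ p ,
  <-≤-trans (s≤s hi) (+-mono-≤ {1} (m^n>0 2 (suc e)) (m≤m+n (2 ^ suc e) 0))

-- The larger of two parts has at least half of the total, so the exponent drops by at most one. At
-- c = 0 the exponent stays 0, and positivity of e suffices.
2^pred≤ : ∀ c {e f} → 0 < e → f ≤ e → 2 ^ c ≤ e + f → 2 ^ pred c ≤ e
2^pred≤ zero 0<e f≤e h = 0<e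
2^pred≤ (suc c) {e} {f} 0<e f≤e h = *-cancelˡ-≤ 2
  (≤-trans h (+-monoʳ-≤ e (≤-trans f≤e (m≤m+n e 0))))

sumℕ-const : ∀ n x → sumℕ {n} (λ _ → x) ≡ n * x
sumℕ-const zero x = refl
sumℕ-const (suc n) x = cong (x +_) (sumℕ-const n x)

sumℕ-mono-* : ∀ {m} (u v : Vector ℕ m) {x y} →
  (∀ i → u i * x ≤ v i * y) → sumℕ u * x ≤ sumℕ v * y
sumℕ-mono-* {zero} u v h = z≤n
sumℕ-mono-* {suc m} u v {x} {y} h
  rewrite ℕ.*-distribʳ-+ x (u zero) (sumℕ (u ∘ suc))
        | ℕ.*-distribʳ-+ y (v zero) (sumℕ (v ∘ suc)) =
  +-mono-≤ (h zero) (sumℕ-mono-* (u ∘ suc) (v ∘ suc) (h ∘ suc))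

-- Counts one split: r products for the larger factor, of order e, times t = n^(f - 1) for the
-- other. The equation `t * n ≡ n ^ f` avoids the subtraction and supplies the further factor n
-- saved by the split.
factor-bound : ∀ n .{{_ : NonZero n}} c r t e {f k β s} →
  r * n ^ suc (pred c) ≤ β * n ^ e → t * n ≡ n ^ f → e + f ≡ k → β ≤ s →
  (r * t) * n ^ suc c ≤ s * n ^ k
factor-bound n c r t e {f} {_} {β} {s} h tn refl β≤s = begin
  (r * t) * n ^ suc c              ≤⟨ *-monoʳ-≤ (r * t) (^-monoʳ-≤ n (s≤s (c≤1+pred c))) ⟩
  (r * t) * n ^ suc (suc (pred c)) ≡⟨ regroup r t n (n ^ suc (pred c)) ⟩
  (r * n ^ suc (pred c)) * (t * n) ≤⟨ *-monoˡ-≤ (t * n) h ⟩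
  (β * n ^ e) * (t * n)            ≡⟨ cong ((β * n ^ e) *_) tn ⟩
  (β * n ^ e) * n ^ f              ≡⟨ ℕ.*-assoc β (n ^ e) (n ^ f) ⟩
  β * (n ^ e * n ^ f)              ≡⟨ cong (β *_) (^-distribˡ-+-* n e f) ⟨
  β * n ^ (e + f)                  ≤⟨ *-monoˡ-≤ (n ^ (e + f)) β≤s ⟩
  s * n ^ (e + f)                  ∎
  where
  open ℕ.≤-Reasoning
  -- Strict only at c = 0, where one saved factor n is given away.
  c≤1+pred : ∀ c → c ≤ suc (pred c)
  c≤1+pred zero = z≤n
  c≤1+pred (suc c) = ≤-refl
  regroup : ∀ r t n x → (r * t) * (n * x) ≡ (r * x) * (t * n)
  regroup = solve-∀

-- For n ≥ 1 the hypothesis says R ≤ L n^(d - e), and d - e = d + 1 - (e + 1) is below d + 1 - log₂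
-- d because d < 2^(e + 1).
^ʳ-bound : ∀ n .{{_ : NonZero n}} d e {R L} → suc d < 2 ^ suc e →
  R * n ^ suc e ≤ L * n ^ suc d → L ≥ R / n ^ʳ d-log₂d+1 d
^ʳ-bound n d e {R} {L} hi h a b x = *-cancelʳ-≤ _ _ _ {{m^n≢0 n (suc e * b)}} (begin
  R ^ b * n ^ (suc e * b)            ≡⟨ cong (R ^ b *_) (^-*-assoc n (suc e) b) ⟨
  R ^ b * (n ^ suc e) ^ b            ≡⟨ ^-distribʳ-* R (n ^ suc e) b ⟨
  (R * n ^ suc e) ^ b                ≤⟨ ^-monoˡ-≤ b h ⟩
  (L * n ^ suc d) ^ b                ≡⟨ ^-distribʳ-* L (n ^ suc d) b ⟩
  L ^ b * (n ^ suc d) ^ b            ≡⟨ cong (L ^ b *_) (^-*-assoc n (suc d) b) ⟩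
  L ^ b * n ^ (suc d * b)            ≤⟨ *-monoʳ-≤ (L ^ b) (^-monoʳ-≤ n exponents) ⟩
  L ^ b * n ^ (a + suc e * b)        ≡⟨ cong (L ^ b *_) (^-distribˡ-+-* n a (suc e * b)) ⟩
  L ^ b * (n ^ a * n ^ (suc e * b))  ≡⟨ ℕ.*-assoc (L ^ b) (n ^ a) (n ^ (suc e * b)) ⟨
  L ^ b * n ^ a * n ^ (suc e * b)    ∎)
  where
  open ℕ.≤-Reasoning
  -- The exponent is only given through powers of two, so the exponents of n are compared there
  -- first.
  powers : 2 ^ (suc d * b) ≤ 2 ^ (a + suc e * b)
  powers = begin
    2 ^ (suc d * b)           ≡⟨ cong (2 ^_) (≡.trans (ℕ.*-comm (suc d) b) (cong (b *_) (ℕ.+-comm 1 d))) ⟩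
    2 ^ (b * (d + 1))         ≤⟨ x ⟩
    2 ^ a * d ^ b             ≤⟨ *-monoʳ-≤ (2 ^ a) (^-monoˡ-≤ b (≤-trans (n≤1+n d) (<⇒≤ hi))) ⟩
    2 ^ a * (2 ^ suc e) ^ b   ≡⟨ cong (2 ^ a *_) (^-*-assoc 2 (suc e) b) ⟩
    2 ^ a * 2 ^ (suc e * b)   ≡⟨ ^-distribˡ-+-* 2 a (suc e * b) ⟨
    2 ^ (a + suc e * b)       ∎
  exponents : suc d * b ≤ a + suc e * b
  exponents = ≮⇒≥ λ lt → <⇒≱ (^-monoʳ-< 2 (s≤s (s≤s z≤n)) lt) powers

-- Quantification over finite sets under a double negation.

AllOrCounterexample : Set → ∀ ℓ → Set (Level.suc ℓ)
AllOrCounterexample X ℓ = (P : X → Set ℓ) → ¬ ¬ ((∀ x → P x) ⊎ (∃ λ x → ¬ P x))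

-- Excluded middle is used once per element, and finitely many uses fit under one double negation,
-- whatever the predicate.
Fin-allOrCounterexample : ∀ n → AllOrCounterexample (Fin n) ℓ
Fin-allOrCounterexample zero P ¬p = ¬p (inj₁ λ ())
Fin-allOrCounterexample (suc n) P ¬p = ¬¬-excluded-middle λ where
  (no ¬P0) → ¬p (inj₂ (zero , ¬P0))
  (yes P0) → Fin-allOrCounterexample n (P ∘ suc) λ where
    (inj₁ all) → ¬p (inj₁ λ { zero → P0 ; (suc i) → all i })
    (inj₂ (i , ¬Pi)) → ¬p (inj₂ (suc i , ¬Pi))

×-allOrCounterexample : AllOrCounterexample X ℓ → AllOrCounterexample Y ℓ →
  AllOrCounterexample (X × Y) ℓ
×-allOrCounterexample X? Y? P ¬p = X? (λ x → ∀ y → P (x , y)) λ where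
  (inj₁ all) → ¬p (inj₁ λ (x , y) → all x y)
  (inj₂ (x , ¬all)) → Y? (λ y → P (x , y)) λ where
    (inj₁ all) → ¬all all
    (inj₂ (y , ¬Pxy)) → ¬p (inj₂ ((x , y) , ¬Pxy))

Vec-allOrCounterexample : ∀ n d → AllOrCounterexample (Vec (Fin n) d) ℓ
Vec-allOrCounterexample n zero P ¬p = ¬¬-excluded-middle λ where
  (no ¬P[]) → ¬p (inj₂ ([] , ¬P[]))
  (yes P[]) → ¬p (inj₁ λ { [] → P[] })
Vec-allOrCounterexample n (suc d) P ¬p =
  ×-allOrCounterexample (Fin-allOrCounterexample n) (Vec-allOrCounterexample n d)
    (λ (x , xs) → P (x ∷ xs)) λ where
      (inj₁ all) → ¬p (inj₁ λ { (x ∷ xs) → all (x , xs) })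
      (inj₂ ((x , xs) , ¬Pxs)) → ¬p (inj₂ (x ∷ xs , ¬Pxs))

-- Index tuples: partial transposes and the shifted tensor.

select : Vec Bool d → Vec X d → Vec X d → Vec X d
select [] [] [] = []
select (b ∷ κ) (x ∷ xs) (y ∷ ys) = (if b then y else x) ∷ select κ xs ys

-- The pair (select κ i j , select κ j i) is (i , j) with the coordinates in κ exchanged; a second
-- exchange restores it.
select-involutive : ∀ κ (xs ys : Vec X d) →
  select κ (select κ xs ys) (select κ ys xs) ≡ xs
select-involutive [] [] [] = refl
select-involutive (true ∷ κ) (x ∷ xs) (y ∷ ys) = cong (x ∷_) (select-involutive κ xs ys)
select-involutive (false ∷ κ) (x ∷ xs) (y ∷ ys) = cong (x ∷_) (select-involutive κ xs ys)

-- The index (⟨p,i₁⟩ , ⟨j₁,i₂⟩ , … , ⟨j_d,q⟩) of the shifted tensor.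
shiftedIndex : Fin n → Vec (Fin n) d → Vec (Fin n) d → Fin n → Vec (Fin (n * n)) (suc d)
shiftedIndex p [] [] q = combine p q ∷ []
shiftedIndex p (i ∷ is) (j ∷ js) q = combine p i ∷ shiftedIndex j is js q

quotient-combine : ∀ (i j : Fin n) → quotient n (combine i j) ≡ i
quotient-combine i j = cong proj₁ (remQuot-combine i j)

remainder-combine : ∀ (i j : Fin n) → remainder {n} n (combine i j) ≡ j
remainder-combine i j = cong proj₂ (remQuot-combine i j)

quotient-head-shiftedIndex : ∀ (p : Fin n) (is js : Vec (Fin n) d) q →
  quotient n (head (shiftedIndex p is js q)) ≡ p
quotient-head-shiftedIndex p [] [] q = quotient-combine p q
quotient-head-shiftedIndex p (i ∷ is) (j ∷ js) q = quotient-combine p i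

map-quotient-tail-shiftedIndex : ∀ (p : Fin n) (is js : Vec (Fin n) d) q →
  Vec.map (quotient n) (tail (shiftedIndex p is js q)) ≡ js
map-quotient-tail-shiftedIndex p [] [] q = refl
map-quotient-tail-shiftedIndex {n} p (_ ∷ []) (j ∷ []) q = cong (_∷ []) (quotient-combine j q)
map-quotient-tail-shiftedIndex p (_ ∷ is@(i ∷ _)) (j ∷ js@(_ ∷ _)) q =
  cong₂ _∷_ (quotient-combine j i) (map-quotient-tail-shiftedIndex j is js q)

map-remainder-init-shiftedIndex : ∀ (p : Fin n) (is js : Vec (Fin n) d) q →
  Vec.map (remainder {n} n) (init (shiftedIndex p is js q)) ≡ is
map-remainder-init-shiftedIndex p [] [] q = refl
map-remainder-init-shiftedIndex p (i ∷ is) (j ∷ js) q =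
  cong₂ _∷_ (remainder-combine p i) (map-remainder-init-shiftedIndex j is js q)

remainder-last-shiftedIndex : ∀ (p : Fin n) (is js : Vec (Fin n) d) q →
  remainder {n} n (last (shiftedIndex p is js q)) ≡ q
remainder-last-shiftedIndex p [] [] q = remainder-combine p q
remainder-last-shiftedIndex p (i ∷ is) (j ∷ js) q = remainder-last-shiftedIndex j is js q

-- In a tensor index (⟨j₀,i₁⟩ , ⟨j₁,i₂⟩ , … , ⟨j_{k-1},i_k⟩), the half j_t has colour κ_t,
-- where κ₀ = a, and the half i_t the opposite colour. Thus i_t and j_t always get different
-- colours, and t is transposed exactly if κ_t is true. Hidden halves are overwritten by o.
module Masking (o : Fin n) where

  keep : Bool → Bool → Fin n → Fin n
  keep b c x = if b xor c then o else x

  -- Depending on x through `mask b a κ x` means depending only on the halves of colour b. As halves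
  -- are overwritten and not deleted, the type does not vary with the colouring, and masking
  -- commutes with `take` and `drop`.
  mask : Bool → Bool → Vec Bool k → Vec (Fin (n * n)) k → Vec (Fin n × Fin n) k
  mask b a [] [] = []
  mask b a (c ∷ κ) (x ∷ xs) =
    (keep b a (quotient n x) , keep b (not c) (remainder {n} n x)) ∷ mask b c κ xs

  keep-not-not : ∀ b c x → keep (not b) (not c) x ≡ keep b c x
  keep-not-not true true x = refl
  keep-not-not true false x = refl
  keep-not-not false true x = refl
  keep-not-not false false x = refl

  -- Only agreement of colours matters, so the two may be renamed into each other. This allows a
  -- colouring to start with either colour.
  mask-flip : ∀ b a (κ : Vec Bool k) x →
    mask (not b) (not a) (Vec.map not κ) x ≡ mask b a κ x
  mask-flip b a [] [] = refl
  mask-flip b a (c ∷ κ) (x ∷ xs) = cong₂ _∷_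
    (cong₂ _,_ (keep-not-not b a _) (keep-not-not b (not c) _)) (mask-flip b c κ xs)

  -- The colour that the quotient of the coordinate right after the interval has to take.
  finalColour : Bool → Vec Bool k → Bool
  finalColour a [] = a
  finalColour a (c ∷ κ) = finalColour c κ

  take-mask : ∀ b a (κ : Vec Bool k) (κ′ : Vec Bool m) x →
    take k (mask b a (κ ++ κ′) x) ≡ mask b a κ (take k x)
  take-mask b a [] κ′ x = refl
  take-mask b a (c ∷ κ) κ′ (x ∷ xs) = cong (_ ∷_) (take-mask b c κ κ′ xs)

  drop-mask : ∀ b a (κ : Vec Bool k) (κ′ : Vec Bool m) x →
    drop k (mask b a (κ ++ κ′) x) ≡ mask b (finalColour a κ) κ′ (drop k x)
  drop-mask b a [] κ′ x = refl
  drop-mask b a (c ∷ κ) κ′ (x ∷ xs) = drop-mask b c κ κ′ xs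

  shiftedIndex′ : Fin n → Vec (Fin n) d → Vec (Fin n) d → Fin n → Vec (Fin (n * n)) (suc d)
  shiftedIndex′ = shiftedIndex {n}

  mask-combine : ∀ b a c (κ : Vec Bool k) {p p′ i i′ xs ys} →
    keep b a p ≡ keep b a p′ → keep b (not c) i ≡ keep b (not c) i′ →
    mask b c κ xs ≡ mask b c κ ys →
    mask b a (c ∷ κ) (combine p i ∷ xs) ≡ mask b a (c ∷ κ) (combine p′ i′ ∷ ys)
  mask-combine b a c κ {p} {p′} {i} {i′} p≡ i≡ xs≡ = cong₂ _∷_
    (cong₂ _,_
      (≡.trans (cong (keep b a) (quotient-combine p i))
        (≡.trans p≡ (cong (keep b a) (≡.sym (quotient-combine p′ i′)))))
      (≡.trans (cong (keep b (not c)) (remainder-combine p i))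
        (≡.trans i≡ (cong (keep b (not c)) (≡.sym (remainder-combine p′ i′))))))
    xs≡

  visible : Bool → Vec Bool d → Vec (Fin n) d → Vec (Fin n) d → Vec (Fin n) d
  visible true κ is js = select κ is js
  visible false κ is js = select κ js is

  -- Exactly one of i_t and j_t has colour b, namely u_t, so u_t may be written in both places. The
  -- first half is allowed to change from p to p′ because in the induction it becomes j_t on one
  -- side and u_t on the other.
  mask-visible : ∀ b a (κ : Vec Bool (suc d)) p p′ is js q → keep b a p ≡ keep b a p′ →
    let u = visible b (init κ) is js in
    mask b a κ (shiftedIndex′ p is js q) ≡ mask b a κ (shiftedIndex′ p′ u u q)
  mask-visible true a (c ∷ []) p p′ [] [] q eq = mask-combine true a c [] eq refl refl
  mask-visible false a (c ∷ []) p p′ [] [] q eq = mask-combine false a c [] eq refl refl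
  mask-visible true a (true ∷ κ@(_ ∷ _)) p p′ (i ∷ is) (j ∷ js) q eq =
    mask-combine true a true κ eq refl (mask-visible true true κ j j is js q refl)
  mask-visible true a (false ∷ κ@(_ ∷ _)) p p′ (i ∷ is) (j ∷ js) q eq =
    mask-combine true a false κ eq refl (mask-visible true false κ j i is js q refl)
  mask-visible false a (true ∷ κ@(_ ∷ _)) p p′ (i ∷ is) (j ∷ js) q eq =
    mask-combine false a true κ eq refl (mask-visible false true κ j i is js q refl)
  mask-visible false a (false ∷ κ@(_ ∷ _)) p p′ (i ∷ is) (j ∷ js) q eq =
    mask-combine false a false κ eq refl (mask-visible false false κ j j is js q refl)

module _ {c ℓ} (F : Field c ℓ) where

  open Field F using (Carrier; _≈_; 0#; 1#; _+F_; _*F_; -_; commutativeRing; 1≉0; inverse)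
  open CommutativeRing commutativeRing using
    ( setoid; ring; semiring; +-congˡ; +-congʳ; +-cong; +-assoc; +-identityˡ; +-identityʳ
    ; *-cong; *-congˡ; *-congʳ; *-assoc; *-comm; *-identityˡ; *-identityʳ
    ; zeroˡ; zeroʳ; distribˡ; distribʳ; -‿inverseʳ; *-commutativeSemigroup )
    renaming (refl to ≈-refl; sym to ≈-sym; trans to ≈-trans; reflexive to ≈-reflexive)
  open Algebra.Properties.CommutativeSemigroup *-commutativeSemigroup
    using (interchange; x∙yz≈y∙xz; x∙yz≈z∙yx)
  open Algebra.Properties.Ring ring using (-‿distribˡ-*)
  open Algebra.Properties.Semiring.Sum semiring using (sum; sum-cong-≋; sum-replicate-zero)
  module ≈-Reasoning = Relation.Binary.Reasoning.Setoid setoid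

  -- Pointwise sums of a counted number of functions with a given property.

  infix 4 _≋_
  _≋_ : (X → Carrier) → (X → Carrier) → Set ℓ
  f ≋ g = ∀ x → f x ≈ g x

  infixl 6 _⊕_
  _⊕_ : (X → Carrier) → (X → Carrier) → X → Carrier
  (f ⊕ g) x = f x +F g x

  𝟘 : X → Carrier
  𝟘 _ = 0#

  data SumOf {X : Set} {p} (P : (X → Carrier) → Set p) :
             ℕ → (X → Carrier) → Set (c ⊔ ℓ ⊔ p) where
    nil  : ∀ {f} → f ≋ 𝟘 → SumOf P 0 f
    cons : ∀ {r f g h} → P g → SumOf P r h → f ≋ g ⊕ h → SumOf P (suc r) f

  private variable
    P : (X → Carrier) → Set ℓ₁
    Q : (Y → Carrier) → Set ℓ₂
    R : (Z → Carrier) → Set ℓ₃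

  SumOf-resp : ∀ {f g} → f ≋ g → SumOf P r f → SumOf P r g
  SumOf-resp f≋g (nil f≋0) = nil λ x → ≈-trans (≈-sym (f≋g x)) (f≋0 x)
  SumOf-resp f≋g (cons p s eq) = cons p s λ x → ≈-trans (≈-sym (f≋g x)) (eq x)

  SumOf-singleton : ∀ {f} → P f → SumOf P 1 f
  SumOf-singleton p = cons p (nil (λ _ → ≈-refl)) λ x → ≈-sym (+-identityʳ _)

  SumOf-⊕ : ∀ {f g} → SumOf P r f → SumOf P s g → SumOf P (r + s) (f ⊕ g)
  SumOf-⊕ (nil f≋0) t =
    SumOf-resp (λ x → ≈-sym (≈-trans (+-congʳ (f≋0 x)) (+-identityˡ _))) t
  SumOf-⊕ (cons p s eq) t =
    cons p (SumOf-⊕ s t) λ x → ≈-trans (+-congʳ (eq x)) (+-assoc _ _ _)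

  SumOf-sum : ∀ (rs : Vector ℕ m) {fs : Vector (X → Carrier) m} →
    (∀ i → SumOf P (rs i) (fs i)) → SumOf P (sumℕ rs) (λ x → sum (λ i → fs i x))
  SumOf-sum {m = zero} rs h = nil λ _ → ≈-refl
  SumOf-sum {m = suc m} rs h = SumOf-⊕ (h zero) (SumOf-sum (rs ∘ suc) (h ∘ suc))

  SumOf-Vector : ∀ {f} → SumOf P r f →
    Σ (Vector (X → Carrier) r) λ gs → (∀ k → P (gs k)) × (∀ x → f x ≈ sum (λ k → gs k x))
  SumOf-Vector (nil f≋0) = (λ ()) , (λ ()) , f≋0
  SumOf-Vector (cons {g = g} p s eq) with gs , ps , h ← SumOf-Vector s =
      (λ { zero → g ; (suc k) → gs k })
    , (λ { zero → p ; (suc k) → ps k })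
    , λ x → ≈-trans (eq x) (+-congˡ (h x))

  SumOf-map : (T : (X → Carrier) → Y → Carrier) →
    (∀ {f} → f ≋ 𝟘 → T f ≋ 𝟘) →
    (∀ {f g h} → f ≋ g ⊕ h → T f ≋ T g ⊕ T h) →
    (∀ {f} → P f → Q (T f)) →
    ∀ {f} → SumOf P r f → SumOf Q r (T f)
  SumOf-map T T0 T⊕ TP (nil f≋0) = nil (T0 f≋0)
  SumOf-map T T0 T⊕ TP (cons p s eq) = cons (TP p) (SumOf-map T T0 T⊕ TP s) (T⊕ eq)

  SumOf-pullback : (φ : Y → X) →
    (∀ {f} → P f → Q (f ∘ φ)) → ∀ {f} → SumOf P r f → SumOf Q r (f ∘ φ)
  SumOf-pullback φ = SumOf-map (_∘ φ) (_∘ φ) (_∘ φ)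

  SumOf-product :     (φ : Z → X) (ψ : Z → Y) →
    (∀ {f g} → P f → Q g → R (λ z → f (φ z) *F g (ψ z))) →
    ∀ {f g} → SumOf P r f → SumOf Q s g → SumOf R (r * s) (λ z → f (φ z) *F g (ψ z))
  SumOf-product φ ψ PQ (nil f≋0) t =
    nil λ z → ≈-trans (*-congʳ (f≋0 (φ z))) (zeroˡ _)
  SumOf-product φ ψ PQ {f} {g} (cons {g = f₀} {h = f₁} p s eq) t =
    SumOf-resp (λ z → ≈-sym (≈-trans (*-congʳ (eq (φ z))) (distribʳ _ _ _)))
      (SumOf-⊕
        (SumOf-map (λ h z → f₀ (φ z) *F h (ψ z))
          (λ h≋0 z → ≈-trans (*-congˡ (h≋0 (ψ z))) (zeroʳ _))
          (λ eq′ z → ≈-trans (*-congˡ (eq′ (ψ z))) (distribˡ _ _ _))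
          (PQ p) t)
        (SumOf-product φ ψ PQ s t))

  -- Separating variables by summing over their values.

  δ : Fin n → Fin n → Carrier
  δ zero zero = 1#
  δ zero (suc j) = 0#
  δ (suc i) zero = 0#
  δ (suc i) (suc j) = δ i j

  sum-0* : ∀ (f : Vector Carrier n) → sum (λ u → 0# *F f u) ≈ 0#
  sum-0* {n} f = ≈-trans (sum-cong-≋ (λ u → zeroˡ (f u))) (sum-replicate-zero n)

  sum-δ : ∀ (f : Vector Carrier n) v → sum (λ u → δ u v *F f u) ≈ f v
  sum-δ f zero = ≈-trans (+-cong (*-identityˡ _) (sum-0* (f ∘ suc))) (+-identityʳ _)
  sum-δ f (suc v) = ≈-trans (+-cong (zeroˡ _) (sum-δ (f ∘ suc) v)) (+-identityˡ _)

  Separable : (X × Y → Carrier) → Set (c ⊔ ℓ)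
  Separable {X = X} {Y = Y} f = Σ (X → Carrier) λ p → Σ (Y → Carrier) λ q →
    ∀ x y → f (x , y) ≈ p x *F q y

  -- Sum, over all n^m tuples u, the function f (x , u) times the indicator that the second argument
  -- is u; every summand is separable. The induction fixes one entry of u at a time.
  SumOf-Separable : ∀ m (f : X × Vec (Fin n) m → Carrier) → SumOf Separable (n ^ m) f
  SumOf-Separable zero f = SumOf-singleton
    ((λ x → f (x , [])) , (λ _ → 1#) , λ { x [] → ≈-sym (*-identityʳ _) })
  SumOf-Separable {n = n} (suc m) f =
    SumOf-resp (λ { (x , v ∷ vs) → sum-δ (λ u → f (x , u ∷ vs)) v })
      (subst (λ r → SumOf Separable r (λ x → sum (λ u → slice u x))) (sumℕ-const n (n ^ m))
        (SumOf-sum (λ _ → n ^ m) SumOf-slice))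
    where
    slice : Fin n → _ × Vec (Fin n) (suc m) → Carrier
    slice u (x , vs) = δ u (head vs) *F f (x , u ∷ tail vs)
    SumOf-slice : ∀ u → SumOf Separable (n ^ m) (slice u)
    SumOf-slice u = SumOf-map (λ g (x , vs) → δ u (head vs) *F g (x , tail vs))
      (λ g≋0 _ → ≈-trans (*-congˡ (g≋0 _)) (zeroʳ _))
      (λ eq _ → ≈-trans (*-congˡ (eq _)) (distribˡ _ _ _))
      (λ (p , q , eq) → p , (λ vs → δ u (head vs) *F q (tail vs)) , λ x vs →
        ≈-trans (*-congˡ (eq x (tail vs))) (x∙yz≈y∙xz _ _ _))
      (SumOf-Separable m (λ (x , vs) → f (x , u ∷ vs)))

  -- Products split by a colouring: true for rows, false for columns.

  module _ (o : Fin n) where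

    open Masking o

    PTProductFrom : Bool → Tensor F (n * n) k → Set (c ⊔ ℓ)
    PTProductFrom {k = k} a f = Σ (Vec Bool k) λ κ →
      Σ (Vec (Fin n × Fin n) k → Carrier) λ p →
      Σ (Vec (Fin n × Fin n) k → Carrier) λ q →
      ∀ x → f x ≈ p (mask true a κ x) *F q (mask false a κ x)

    PTProduct : Tensor F (n * n) k → Set (c ⊔ ℓ)
    PTProduct f = ∃ λ a → PTProductFrom a f

    PTProductFrom-not : ∀ {a} {f : Tensor F (n * n) k} →
      PTProductFrom a f → PTProductFrom (not a) f
    PTProductFrom-not {a = a} (κ , p , q , eq) = Vec.map not κ , q , p , λ x →
      ≈-trans (eq x) (≈-trans (*-comm _ _)
        (≈-reflexive (≡.sym (cong₂ (λ y z → q y *F p z)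
          (mask-flip false a κ x) (mask-flip true a κ x)))))

    PTProduct⇒From : ∀ b {f : Tensor F (n * n) k} → PTProduct f → PTProductFrom b f
    PTProduct⇒From true (true , P) = P
    PTProduct⇒From true (false , P) = PTProductFrom-not P
    PTProduct⇒From false (true , P) = PTProductFrom-not P
    PTProduct⇒From false (false , P) = P

    -- The second factor is recoloured to start with the colour at which the first one ends, so the
    -- colourings join. Row parts then multiply to a row part, and column parts to a column part.
    PTProduct-⊗ : ∀ {e f} {B : Tensor F (n * n) e} {C : Tensor F (n * n) f} →
      PTProduct B → PTProduct C → PTProduct (tensorProduct F B C)
    PTProduct-⊗ {e} (a , κ , p , q , eqB) PC
      with κ′ , p′ , q′ , eqC ← PTProduct⇒From (finalColour a κ) PC =
      a , κ ++ κ′ , (λ y → p (take e y) *F p′ (drop e y)) , (λ y → q (take e y) *F q′ (drop e y)) ,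
      λ x → ≈-trans (*-cong (eqB (take e x)) (eqC (drop e x)))
        (≈-trans (interchange _ _ _ _)
          (≈-reflexive (≡.sym (cong₂ _*F_
            (cong₂ (λ y z → p y *F p′ z) (take-mask true a κ κ′ x) (drop-mask true a κ κ′ x))
            (cong₂ (λ y z → q y *F q′ z) (take-mask false a κ κ′ x) (drop-mask false a κ κ′ x))))))

    SumOf-⊗ : ∀ {e f} (e+f≡k : e + f ≡ k) {B : Tensor F (n * n) e} {C : Tensor F (n * n) f} →
      SumOf PTProduct r B → SumOf PTProduct s C →
      SumOf PTProduct (r * s) (λ x → tensorProduct F B C (cast (≡.sym e+f≡k) x))
    SumOf-⊗ {e = e} refl {B} {C} SB SC =
      SumOf-resp (λ x → ≈-reflexive (cong (tensorProduct F B C) (≡.sym (cast-is-id refl x))))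
        (SumOf-product (take e) (drop e) PTProduct-⊗ SB SC)

    -- Give the m inner quotients j_1, ..., j_m to the columns and all other halves to the rows,
    -- then sum over the n^m values of the inner quotients.
    SumOf-any : ∀ m (A : Tensor F (n * n) (suc m)) → SumOf PTProduct (n ^ m) A
    SumOf-any m A =
      SumOf-resp (λ x → ≈-reflexive (cong A (rebuild-split x)))
        (SumOf-pullback split PTsplit (SumOf-Separable m (A ∘ rebuild)))
      where
      internal : Vec Bool k
      internal = Vec.replicate _ false
      rebuildTail : Vec (Fin n × Fin n) k → Vec (Fin n) k → Vec (Fin (n * n)) k
      rebuildTail [] [] = []
      rebuildTail ((_ , i) ∷ ys) (j ∷ js) = combine j i ∷ rebuildTail ys js
      rebuild : Vec (Fin n × Fin n) (suc k) × Vec (Fin n) k → Vec (Fin (n * n)) (suc k)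
      rebuild ((j , i) ∷ ys , js) = combine j i ∷ rebuildTail ys js
      split : Vec (Fin (n * n)) (suc k) → Vec (Fin n × Fin n) (suc k) × Vec (Fin n) k
      split x = mask true true internal x ,
                -- The first quotient j_0 is a row half, so the column part starts at the second
                -- coordinate.
                Vec.map proj₁ (tail (mask false true internal x))
      rebuildTail-split : ∀ (x : Vec (Fin (n * n)) k) →
        rebuildTail (mask true false internal x) (Vec.map proj₁ (mask false false internal x)) ≡ x
      rebuildTail-split [] = refl
      rebuildTail-split (x ∷ xs) = cong₂ _∷_ (combine-remQuot {n} n x) (rebuildTail-split xs)
      rebuild-split : ∀ (x : Vec (Fin (n * n)) (suc k)) → rebuild (split x) ≡ x
      rebuild-split (x ∷ xs) = cong₂ _∷_ (combine-remQuot {n} n x) (rebuildTail-split xs)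
      PTsplit : ∀ {f : Vec (Fin n × Fin n) (suc m) × Vec (Fin n) m → Carrier} →
        Separable f → PTProduct (f ∘ split)
      PTsplit (p , q , eq) =
        true , internal , p , (λ y → q (Vec.map proj₁ (tail y))) , λ x → eq _ _

    -- The bound reads r ≤ s n^(k - l - 1). A tensor of order k alone costs n^(k - 1) products;
    -- every split saves a factor n, and following the larger factor guarantees l splits.
    SumOf-size : .{{_ : NonZero n}} → ∀ k (ac : Acc _<_ k) (A : Tensor F (n * n) k) s →
      IsNcSmSizeAcc F k ac A s → ∀ l → 2 ^ l ≤ k →
      ∃ λ r → SumOf PTProduct r A × r * n ^ suc l ≤ s * n ^ k
    SumOf-size 1 ac A s _ (suc l) 2^l≤1 =
      contradiction 2^l≤1 (<⇒≱ (*-monoʳ-≤ 2 (m^n>0 2 l)))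
    SumOf-size 1 ac A s (lift (inj₁ (_ , refl))) zero _ = 1 , SumOf-any 0 A , ≤-refl
    SumOf-size 1 ac A s (lift (inj₂ (A≋0 , refl))) zero _ = 0 , nil A≋0 , z≤n
    SumOf-size k@(suc (suc _)) (acc rec) A s
      ((m , P , β , γ , sizeB , sizeC , A≋ , refl) , _) l 2^l≤k =
        sumℕ (proj₁ ∘ summand)
      , SumOf-resp (λ x → ≈-sym (A≋ x))
          (SumOf-sum (proj₁ ∘ summand) (λ i → proj₁ (proj₂ (summand i))))
      , sumℕ-mono-* (proj₁ ∘ summand) (λ i → β i + γ i) (λ i → proj₂ (proj₂ (summand i)))
      where
      open ProductTerm
      trivial : ∀ e → 0 < e → (A : Tensor F (n * n) e) → ∃ λ t → SumOf PTProduct t A × t * n ≡ n ^ e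
      trivial (suc m) _ A = n ^ m , SumOf-any m A , ℕ.*-comm (n ^ m) n
      f+e≡k : ∀ i → f (P i) + e (P i) ≡ k
      f+e≡k i = ≡.trans (ℕ.+-comm (f (P i)) (e (P i))) (e+f≡k (P i))
      summand : ∀ i → ∃ λ r → SumOf PTProduct r (term (P i)) ×
        r * n ^ suc l ≤ (β i + γ i) * n ^ k
      summand i with ≤-total (f (P i)) (e (P i))
      -- The first factor has order at least 2^(l - 1) and is expanded further; the second is
      -- separated by `trivial`. The count is charged to β i ≤ β i + γ i.
      ... | inj₁ f≤e
        with rB , SB , boundB ← SumOf-size (e (P i)) (rec (e<k (P i))) (B (P i)) (β i) (sizeB i) (pred l)
               (2^pred≤ l (0<e (P i)) f≤e (subst (2 ^ l ≤_) (≡.sym (e+f≡k (P i))) 2^l≤k))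
           | t , SC , tn ← trivial (f (P i)) (0<f (P i)) (C (P i)) =
          rB * t , SumOf-⊗ (e+f≡k (P i)) SB SC
        , factor-bound n l rB t (e (P i)) boundB tn (e+f≡k (P i)) (m≤m+n (β i) (γ i))
      ... | inj₂ e≤f
        with rC , SC , boundC ← SumOf-size (f (P i)) (rec (f<k (P i))) (C (P i)) (γ i) (sizeC i) (pred l)
               (2^pred≤ l (0<f (P i)) e≤f (subst (2 ^ l ≤_) (≡.sym (f+e≡k i)) 2^l≤k))
           | t , SB , tn ← trivial (e (P i)) (0<e (P i)) (B (P i)) =
          t * rC , SumOf-⊗ (e+f≡k (P i)) SB SC
        , subst (λ r → r * n ^ suc l ≤ (β i + γ i) * n ^ k) (ℕ.*-comm rC t)
            (factor-bound n l rC t (f (P i)) boundC tn (f+e≡k i) (m≤n+m (γ i) (β i)))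

  -- Matrices with a partial transpose of rank at most one; zero is included.

  PTSeparable : (Vec (Fin n) d × Vec (Fin n) d → Carrier) → Set (c ⊔ ℓ)
  PTSeparable {n = n} {d = d} g = Σ (Subset d) λ κ →
    Σ (Vec (Fin n) d → Carrier) λ p → Σ (Vec (Fin n) d → Carrier) λ q →
    ∀ i j → g (i , j) ≈ p (select κ i j) *F q (select κ j i)

  PTProduct⇒PTSeparable : (o : Fin n) {f : Tensor F (n * n) (suc d)} → PTProduct o f →
    PTSeparable (λ (i , j) → f (shiftedIndex o i j o))
  PTProduct⇒PTSeparable o (a , κ , p , q , eq) =
      -- The last colour only concerns the boundary half q, so it belongs to no pair (i_t , j_t).
      init κ
    , (λ u → p (mask true a κ (shiftedIndex o u u o)))
    , (λ u → q (mask false a κ (shiftedIndex o u u o)))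
    , λ i j → ≈-trans (eq _) (≈-reflexive (cong₂ (λ y z → p y *F q z)
        (mask-visible true a κ o o i j o refl) (mask-visible false a κ o o i j o refl)))
    where open Masking o

  -- Transposing later positions keeps the first row and column indices, so it acts within one slice
  -- of M.
  foldr-transpose-suc : ∀ b (κ : Subset d) (M : Matrix F n (suc d)) (ks : Vector (Fin d) m) i is j js →
    List.foldr (λ k M′ → if lookup (b ∷ κ) k then partialTranspose F k M′ else M′)
      M (List.tabulate (suc ∘ ks)) (i ∷ is) (j ∷ js)
    ≡ List.foldr (λ k M′ → if lookup κ k then partialTranspose F k M′ else M′)
        (λ is js → M (i ∷ is) (j ∷ js)) (List.tabulate ks) is js
  foldr-transpose-suc {m = zero} b κ M ks i is j js = refl
  foldr-transpose-suc {m = suc m} b κ M ks i is j js with lookup κ (ks zero)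
  ... | true = foldr-transpose-suc b κ M (ks ∘ suc) i _ j _
  ... | false = foldr-transpose-suc b κ M (ks ∘ suc) i is j js

  partialTransposes≡select : ∀ (κ : Subset d) (M : Matrix F n d) i j →
    partialTransposes F κ M i j ≡ M (select κ i j) (select κ j i)
  partialTransposes≡select [] M [] [] = refl
  partialTransposes≡select (true ∷ κ) M (i ∷ is) (j ∷ js) =
    ≡.trans (foldr-transpose-suc true κ M id j is i js)
            (partialTransposes≡select κ (λ is js → M (j ∷ is) (i ∷ js)) is js)
  partialTransposes≡select (false ∷ κ) M (i ∷ is) (j ∷ js) =
    ≡.trans (foldr-transpose-suc false κ M id i is j js)
            (partialTransposes≡select κ (λ is js → M (i ∷ is) (j ∷ js)) is js)

  -- Non-zero separable matrices have rank one.

  *-cancel-≉0 : ∀ {x y} → ¬ (y ≈ 0#) → x *F y ≈ 0# → x ≈ 0#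
  *-cancel-≉0 {x} {y} y≉0 xy≈0 with y⁻¹ , _ , yy⁻¹≈1 ← inverse y y≉0 = begin
    x                ≈⟨ *-identityʳ x ⟨
    x *F 1#          ≈⟨ *-congˡ yy⁻¹≈1 ⟨
    x *F (y *F y⁻¹)  ≈⟨ *-assoc x y y⁻¹ ⟨
    x *F y *F y⁻¹    ≈⟨ *-congʳ xy≈0 ⟩
    0# *F y⁻¹        ≈⟨ zeroˡ y⁻¹ ⟩
    0#               ∎
    where open ≈-Reasoning

  ⟨_,_,𝟘⟩ : Carrier → Carrier → Vector Carrier (suc (suc m))
  ⟨ x , y ,𝟘⟩ zero = x
  ⟨ x , y ,𝟘⟩ (suc zero) = y
  ⟨ x , y ,𝟘⟩ (suc (suc _)) = 0#

  sum-⟨,,𝟘⟩ : ∀ x y (v : Vector Carrier (suc (suc m))) →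
    sum (λ k → ⟨ x , y ,𝟘⟩ k *F v k) ≈ x *F v zero +F y *F v (suc zero)
  sum-⟨,,𝟘⟩ x y v = +-congˡ (≈-trans (+-congˡ (sum-0* (λ k → v (suc (suc k))))) (+-identityʳ _))

  -- The column of a non-zero entry is independent. All columns are multiples of p, so two or more
  -- are dependent; the argument avoids deciding which multiples vanish.
  Separable⇒IsRank-1 : ∀ (N : Matrix F n d) (p q : Vec (Fin n) d → Carrier) →
    (∀ i j → N i j ≈ p i *F q j) →
    ∀ {i j} → ¬ (N i j ≈ 0#) → IsRank F N 1
  Separable⇒IsRank-1 N p q N≈ {i} {j} Nij≉0 =
      ((λ _ → j) , λ α α≈0 → λ { zero → *-cancel-≉0 Nij≉0 (≈-trans (≈-sym (+-identityʳ _)) (α≈0 i)) })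
    , λ { zero _ → z≤n
        ; (suc zero) _ → ≤-refl
        ; (suc (suc t)) (js , independent) → contradiction (1≈0 js independent) 1≉0 }
    where
    open ≈-Reasoning
    module _ {t} (js : Vector _ (suc (suc t)))
             (independent : LinearlyIndependent F (λ k i → N i (js k))) where
      q₀ q₁ : Carrier
      q₀ = q (js zero)
      q₁ = q (js (suc zero))
      q₁≈0 : q₁ ≈ 0#
      -- The columns are q₀ p and q₁ p, so the coefficients q₁ and - q₀ cancel them.
      q₁≈0 = independent ⟨ q₁ , - q₀ ,𝟘⟩ (λ i → begin
        sum (λ k → ⟨ q₁ , - q₀ ,𝟘⟩ k *F N i (js k))
          ≈⟨ sum-⟨,,𝟘⟩ q₁ (- q₀) (λ k → N i (js k)) ⟩
        q₁ *F N i (js zero) +F - q₀ *F N i (js (suc zero))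
          ≈⟨ +-cong (*-congˡ (N≈ i _)) (*-congˡ (N≈ i _)) ⟩
        q₁ *F (p i *F q₀) +F - q₀ *F (p i *F q₁)
          ≈⟨ +-cong (x∙yz≈z∙yx q₁ (p i) q₀) (≈-sym (-‿distribˡ-* q₀ _)) ⟩
        q₀ *F (p i *F q₁) +F - (q₀ *F (p i *F q₁))
          ≈⟨ -‿inverseʳ _ ⟩
        0# ∎) zero
      1≈0 : 1# ≈ 0#
      -- With q₁ zero the second column vanishes, so it may carry the coefficient 1.
      1≈0 = independent ⟨ 0# , 1# ,𝟘⟩ (λ i → begin
        sum (λ k → ⟨ 0# , 1# ,𝟘⟩ k *F N i (js k))
          ≈⟨ sum-⟨,,𝟘⟩ 0# 1# (λ k → N i (js k)) ⟩
        0# *F N i (js zero) +F 1# *F N i (js (suc zero))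
          ≈⟨ +-cong (zeroˡ _) (*-identityˡ _) ⟩
        0# +F N i (js (suc zero))
          ≈⟨ +-identityˡ _ ⟩
        N i (js (suc zero))
          ≈⟨ N≈ i _ ⟩
        p i *F q₁
          ≈⟨ *-congˡ q₁≈0 ⟩
        p i *F 0#
          ≈⟨ zeroʳ _ ⟩
        0# ∎) (suc zero)

  -- PT-basic summands and the PT-rank.

  PTSeparable⇒PTBasic : ∀ {g : Vec (Fin n) d × Vec (Fin n) d → Carrier} → PTSeparable g →
    (∃ λ x → ¬ (g x ≈ 0#)) → PTBasic F (curry g)
  PTSeparable⇒PTBasic {g = g} (κ , p , q , eq) ((i , j) , g≉0) =
    κ , Separable⇒IsRank-1 (partialTransposes F κ (curry g)) p q
      (λ i j → ≈-trans (≈-reflexive (partialTransposes≡select κ (curry g) i j))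
        (≈-trans (eq _ _) (≈-reflexive
          (cong₂ (λ i j → p i *F q j) (select-involutive κ i j) (select-involutive κ j i)))))
      -- The partial transpose moves the non-zero entry (i , j) of g to this position.
      {select κ i j} {select κ j i}
      (subst (λ x → ¬ (x ≈ 0#)) (≡.sym (≡.trans
        (partialTransposes≡select κ (curry g) _ _)
        (cong₂ (curry g) (select-involutive κ i j) (select-involutive κ j i)))) g≉0)

  -- A PT-basic matrix has a non-zero partial transpose, so vanishing summands are dropped, which
  -- can only shorten the sum.
  SumOf-PTBasic : ∀ {f : Vec (Fin n) d × Vec (Fin n) d → Carrier} → SumOf PTSeparable r f →
    ¬ ¬ (∃ λ r′ → r′ ≤ r × SumOf (PTBasic F ∘ curry) r′ f)
  SumOf-PTBasic (nil f≋0) ¬s = ¬s (0 , z≤n , nil f≋0)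
  SumOf-PTBasic {n} {d} (cons {g = g} p s eq) ¬s =
    ×-allOrCounterexample (Vec-allOrCounterexample n d) (Vec-allOrCounterexample n d)
      (λ x → g x ≈ 0#) λ where
        (inj₁ g≋0) → SumOf-PTBasic s λ (r′ , r′≤r , s′) → ¬s
          (r′ , m≤n⇒m≤1+n r′≤r , SumOf-resp
            (λ x → ≈-sym (≈-trans (eq x) (≈-trans (+-congʳ (g≋0 x)) (+-identityˡ _)))) s′)
        (inj₂ g≉0) → SumOf-PTBasic s λ (r′ , r′≤r , s′) → ¬s
          (suc r′ , s≤s r′≤r , cons (PTSeparable⇒PTBasic p g≉0) s′ eq)

  IsPTRank-≤ : ∀ {M : Matrix F n d} {R} → IsPTRank F M r →
    SumOf PTSeparable R (λ (i , j) → M i j) → r ≤ R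
  IsPTRank-≤ (_ , least) s = decidable-stable (_ ≤? _) λ r≰R →
    SumOf-PTBasic s λ (r′ , r′≤R , s′) →
      let Bs , basic , eq = SumOf-Vector s′ in
      r≰R (≤-trans (least r′ ((λ k → curry (Bs k)) , basic , λ i j → eq (i , j))) r′≤R)

  ShiftedTensor-shiftedIndex : ∀ (M : Matrix F (suc n) d) i j →
    ShiftedTensor F M (shiftedIndex zero i j zero) ≡ M i j
  ShiftedTensor-shiftedIndex {n = n} M i j
    rewrite quotient-head-shiftedIndex {suc n} zero i j zero
          | remainder-last-shiftedIndex {suc n} zero i j zero
          | map-remainder-init-shiftedIndex {suc n} zero i j zero
          | map-quotient-tail-shiftedIndex {suc n} zero i j zero = refl

theorem4p2 : ∀ {c ℓ} (F : Field c ℓ) (n d : ℕ) → 1 ≤ n → 1 ≤ d →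
    (M : Matrix F n d) (L r : ℕ) →
    IsNcSmSize F (ShiftedTensor F M) L →
    IsPTRank F M r →
    L ≥ r / n ^ʳ d-log₂d+1 d
theorem4p2 F n@(suc _) d _ _ M L r size rank a b x
  with e , lo , hi ← ∃⌊log₂⌋ d
  -- The overwriting value `zero` is also the boundary value p = q at which the shifted tensor
  -- carries the entries of M.
  with R , S , bound ← SumOf-size F {n = n} zero (suc d) (<-wellFounded (suc d))
         (ShiftedTensor F M) L size e lo =
  ≤-trans (^-monoˡ-≤ b r≤R) (^ʳ-bound n d e hi bound a b x)
  where
  open Field F using (reflexive)
  r≤R : r ≤ R
  r≤R = IsPTRank-≤ F {M = M} rank
    (SumOf-resp F (λ (i , j) → reflexive (ShiftedTensor-shiftedIndex F M i j))
      (SumOf-pullback F (λ (i , j) → shiftedIndex zero i j zero)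
        (PTProduct⇒PTSeparable F zero) S))
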